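{- There is an infinite monoid whose first-order theory is binary, and there is an infinite groupoid whose first-order theory is binary.
   Context: A groupoid here is a set with one binary operation (a magma). The theory of a monoid or groupoid $\mathcal{M}$ is its complete first-order theory $\mathrm{Th}(\mathcal{M})$ in the language of the operation (together with the unit $e$ in the case of a monoid). A theory $T$ is binary ($2$-ary) if every formula $\varphi(\overline{x})$ (without parameters) in the language of $T$ is $T$-equivalent to a Boolean combination of formulas without parameters each of which has two free variables (i.e. at most two, dummy variables being allowed). -}

module Defs where

open import Algebra.Bundles using (Magma; Monoid)
open import Data.Empty using (⊥)
open import Data.Fin using (Fin; zero; suc)
open import Data.Fin.Subset using (Subset; ∣_∣; _∈_)
open import Data.Nat using (ℕ; zero; suc; _≤_)
open import Data.Product using (∃-syntax; _×_)
open import Data.Sum using (_⊎_)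
open import Data.Vec.Functional using (Vector; []; _∷_)
open import Data.Vec.Functional.Relation.Binary.Pointwise using (Pointwise)
open import Function.Bundles using (Inverse)
open import Level using (0ℓ)
open import Relation.Binary.Bundles using (Setoid)
open import Relation.Binary.PropositionalEquality using (_≡_; setoid)
open import Relation.Nullary using (¬_)
open import Relation.Unary using (Pred)

-- Underlying sets are setoids, as in Algebra.Bundles; being infinite means
-- not being in bijection, up to the setoid equality, with any Fin n.
Finite : Setoid 0ℓ 0ℓ → Set
Finite S = ∃[ n ] Inverse (setoid (Fin n)) S

Infinite : Setoid 0ℓ 0ℓ → Set
Infinite S = ¬ Finite S

-- First-order languages with equality and operation symbols only:
-- L k is the set of operation symbols of arity k.
Language : Set₁
Language = ℕ → Set

data Term (L : Language) (n : ℕ) : Set where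
  var : Fin n → Term L n
  op  : ∀ {k} → L k → Vector (Term L n) k → Term L n

infix  8 _≐_
infixr 7 _∧′_
infixr 6 _∨′_
infixr 5 _⇒′_
infix  4 _⇔′_

-- Formula L n: formulas whose free variables are among x₀, …, xₙ₋₁.
-- Variables are de Bruijn indices: all′ and ex′ bind the variable zero of
-- their body, in which xᵢ becomes suc i.
data Formula (L : Language) (n : ℕ) : Set where
  _≐_  : Term L n → Term L n → Formula L n
  ⊥′   : Formula L n
  _∧′_ : Formula L n → Formula L n → Formula L n
  _∨′_ : Formula L n → Formula L n → Formula L n
  _⇒′_ : Formula L n → Formula L n → Formula L n
  all′ : Formula L (suc n) → Formula L n
  ex′  : Formula L (suc n) → Formula L n

¬′_ : ∀ {L n} → Formula L n → Formula L n
¬′ φ = φ ⇒′ ⊥′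

_⇔′_ : ∀ {L n} → Formula L n → Formula L n → Formula L n
φ ⇔′ ψ = (φ ⇒′ ψ) ∧′ (ψ ⇒′ φ)

Sentence : Language → Set
Sentence L = Formula L 0

closure : ∀ {L} n → Formula L n → Sentence L
closure zero    φ = φ
closure (suc n) φ = closure n (all′ φ)

OccursIn : ∀ {L n} → Fin n → Term L n → Set
OccursIn i (var j)  = i ≡ j
OccursIn i (op f t) = ∃[ j ] OccursIn i (t j)

FreeIn : ∀ {L n} → Fin n → Formula L n → Set
FreeIn i (s ≐ t)  = OccursIn i s ⊎ OccursIn i t
FreeIn i ⊥′       = ⊥
FreeIn i (φ ∧′ ψ) = FreeIn i φ ⊎ FreeIn i ψ
FreeIn i (φ ∨′ ψ) = FreeIn i φ ⊎ FreeIn i ψ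
FreeIn i (φ ⇒′ ψ) = FreeIn i φ ⊎ FreeIn i ψ
FreeIn i (all′ φ) = FreeIn (suc i) φ
FreeIn i (ex′ φ)  = FreeIn (suc i) φ

record Structure (L : Language) : Set₁ where
  field
    domain : Setoid 0ℓ 0ℓ
  open Setoid domain public using (Carrier; _≈_)
  field
    interp      : ∀ {k} → L k → Vector Carrier k → Carrier
    interp-cong : ∀ {k} (f : L k) {xs ys : Vector Carrier k} →
                  Pointwise _≈_ xs ys → interp f xs ≈ interp f ys

module _ {L : Language} (𝓜 : Structure L) where
  open Structure 𝓜

  eval : ∀ {n} → Vector Carrier n → Term L n → Carrier
  eval ρ (var i)  = ρ i
  eval ρ (op f t) = interp f (λ j → eval ρ (t j))

  Sat : ∀ {n} → Vector Carrier n → Formula L n → Set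
  Sat ρ (s ≐ t)  = eval ρ s ≈ eval ρ t
  Sat ρ ⊥′       = ⊥
  Sat ρ (φ ∧′ ψ) = Sat ρ φ × Sat ρ ψ
  Sat ρ (φ ∨′ ψ) = Sat ρ φ ⊎ Sat ρ ψ
  Sat ρ (φ ⇒′ ψ) = Sat ρ φ → Sat ρ ψ
  Sat ρ (all′ φ) = ∀ a → Sat (a ∷ ρ) φ
  Sat ρ (ex′ φ)  = ∃[ a ] Sat (a ∷ ρ) φ

_⊨_ : ∀ {L} → Structure L → Sentence L → Set
𝓜 ⊨ φ = Sat 𝓜 [] φ

Theory : Language → Set₁
Theory L = Pred (Sentence L) 0ℓ

Th : ∀ {L} → Structure L → Theory L
Th 𝓜 φ = 𝓜 ⊨ φ

_IsModelOf_ : ∀ {L} → Structure L → Theory L → Set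
𝓝 IsModelOf T = ∀ φ → T φ → 𝓝 ⊨ φ

-- Domains in the lowest universe are enough for the usual notion of
-- consequence, by the downward Löwenheim–Skolem theorem.
_⊩_ : ∀ {L} → Theory L → Sentence L → Set₁
T ⊩ φ = ∀ 𝓝 → 𝓝 IsModelOf T → 𝓝 ⊨ φ

Equivalent : ∀ {L n} → Theory L → Formula L n → Formula L n → Set₁
Equivalent {n = n} T φ ψ = T ⊩ closure n (φ ⇔′ ψ)

data BooleanCombination {L n} (P : Pred (Formula L n) 0ℓ) : Pred (Formula L n) 0ℓ where
  base : ∀ {φ}   → P φ → BooleanCombination P φ
  neg  : ∀ {φ}   → BooleanCombination P φ → BooleanCombination P (¬′ φ)
  conj : ∀ {φ ψ} → BooleanCombination P φ → BooleanCombination P ψ →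
         BooleanCombination P (φ ∧′ ψ)
  disj : ∀ {φ ψ} → BooleanCombination P φ → BooleanCombination P ψ →
         BooleanCombination P (φ ∨′ ψ)

-- At most two free variables, but any two of x₀, …, xₙ₋₁.
TwoFreeVariables : ∀ {L n} → Pred (Formula L n) 0ℓ
TwoFreeVariables {n = n} φ =
  ∃[ V ] (∣ V ∣ ≤ 2 × (∀ (i : Fin n) → FreeIn i φ → i ∈ V))

Binary : ∀ {L} → Theory L → Set₁
Binary {L} T = ∀ {n} (φ : Formula L n) →
  ∃[ ψ ] (BooleanCombination TwoFreeVariables ψ × Equivalent T φ ψ)

data GroupoidOp : Language where
  mul : GroupoidOp 2

data MonoidOp : Language where
  mul  : MonoidOp 2
  unit : MonoidOp 0

groupoidStructure : Magma 0ℓ 0ℓ → Structure GroupoidOp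
groupoidStructure G = record
  { domain      = setoid′
  ; interp      = λ { mul xs → xs zero ∙ xs (suc zero) }
  ; interp-cong = λ { mul eq → ∙-cong (eq zero) (eq (suc zero)) }
  }
  where open Magma G renaming (setoid to setoid′)

monoidStructure : Monoid 0ℓ 0ℓ → Structure MonoidOp
monoidStructure M = record
  { domain      = setoid′
  ; interp      = λ { mul xs → xs zero ∙ xs (suc zero) ; unit _ → ε }
  ; interp-cong = λ { mul eq → ∙-cong (eq zero) (eq (suc zero)) ; unit _ → refl }
  }
  where open Monoid M renaming (setoid to setoid′)

{-# OPTIONS --safe #-}
-- Adjoin a unit 0 to the left-zero semigroup on the positive integers. Terms
-- only select one of their arguments or 0, so whether a tuple satisfies a
-- formula depends only on which of its entries are equal to each other and
-- which are 0. This is a back-and-forth argument: a further element either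
-- occurs already (or is 0), or is fresh, and a fresh one always exists. There
-- are finitely many such equality patterns of n-tuples, each described by
-- formulas "xᵢ = xⱼ" and "xᵢ is the left unit" and their negations, and a formula
-- is equivalent to the disjunction of the patterns that satisfy it.
module Submission where

open import Defs
open import Algebra.Bundles using (Magma; Monoid)
open import Data.Product using (Σ-syntax; _×_)
open import Level using (0ℓ)
open import Algebra.Definitions using (Associative; Identity)
open import Data.Bool using (true; false)
open import Data.Empty using (⊥-elim)
open import Data.Fin using (Fin; zero; suc)
open import Data.Fin.Properties using (any?; ℕ→Fin-notInjective)
open import Data.Fin.Subset as Subset using (Subset; ∣_∣; _∪_; ⁅_⁆)
open import Data.Fin.Subset.Properties using (∣⁅x⁆∣≡1; ∣⊥∣≡0; x∈⁅x⁆; x∈p∪q⁺)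
open import Data.List as List using (List; concatMap; filter)
open import Data.List.Membership.Propositional using (find; lose)
open import Data.List.Membership.Propositional.Properties using (∈-filter⁺; ∈-filter⁻)
open import Data.List.Relation.Unary.All as All using ()
open import Data.List.Relation.Unary.Any as Any using (Any; here; there)
open import Data.List.Relation.Unary.Any.Properties using (concatMap⁺; map⁺; tabulate⁺)
open import Data.Nat using (ℕ; zero; suc; _+_; _⊔_; _≤_; z≤n; s≤s; _≟_)
open import Data.Nat.Properties
  using (≤-reflexive; ≤-trans; m≤m⊔n; m≤n⊔m; m≤n⇒m≤1+n; 1+n≰n; +-suc; +-mono-≤)
open import Data.Product using (∃-syntax; _,_; proj₁; proj₂; swap)
open import Data.Sum as Sum using (inj₁; inj₂)
open import Data.Vec as Vec using ()
open import Data.Vec.Functional using (Vector; []; _∷_; tail; foldr)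
open import Function using (_∘_; id; case_of_)
open import Function.Bundles using (Inverse)
open import Relation.Binary.Definitions using (Decidable)
open import Relation.Binary.PropositionalEquality
  using (_≡_; refl; sym; trans; cong; cong₂; setoid; isEquivalence)
open import Relation.Nullary using (¬_; Dec; yes; no; contradiction)
open import Relation.Nullary.Decidable using (_×-dec_; _⊎-dec_; _→-dec_; map′)

-- Subset sizes and infinitude of the natural numbers

∣p∪q∣≤∣p∣+∣q∣ : ∀ {n} (p q : Subset n) → ∣ p ∪ q ∣ ≤ ∣ p ∣ + ∣ q ∣
∣p∪q∣≤∣p∣+∣q∣ Vec.[]          Vec.[]          = z≤n
∣p∪q∣≤∣p∣+∣q∣ (false Vec.∷ p) (false Vec.∷ q) = ∣p∪q∣≤∣p∣+∣q∣ p q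
∣p∪q∣≤∣p∣+∣q∣ (false Vec.∷ p) (true  Vec.∷ q) =
  ≤-trans (s≤s (∣p∪q∣≤∣p∣+∣q∣ p q)) (≤-reflexive (sym (+-suc ∣ p ∣ ∣ q ∣)))
∣p∪q∣≤∣p∣+∣q∣ (true  Vec.∷ p) (false Vec.∷ q) = s≤s (∣p∪q∣≤∣p∣+∣q∣ p q)
∣p∪q∣≤∣p∣+∣q∣ (true  Vec.∷ p) (true  Vec.∷ q) =
  s≤s (≤-trans (m≤n⇒m≤1+n (∣p∪q∣≤∣p∣+∣q∣ p q)) (≤-reflexive (sym (+-suc ∣ p ∣ ∣ q ∣))))

∣⁅i⁆∪⁅j⁆∣≤2 : ∀ {n} (i j : Fin n) → ∣ ⁅ i ⁆ ∪ ⁅ j ⁆ ∣ ≤ 2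
∣⁅i⁆∪⁅j⁆∣≤2 i j = ≤-trans (∣p∪q∣≤∣p∣+∣q∣ ⁅ i ⁆ ⁅ j ⁆)
  (+-mono-≤ (≤-reflexive (∣⁅x⁆∣≡1 i)) (≤-reflexive (∣⁅x⁆∣≡1 j)))

ℕ-infinite : Infinite (setoid ℕ)
ℕ-infinite (n , inv) = ℕ→Fin-notInjective from
  (λ {x} {y} eq → trans (sym (strictlyInverseˡ x)) (trans (cong to eq) (strictlyInverseˡ y)))
  where open Inverse inv

-- Formulas and Boolean combinations

BinaryCombination : ∀ {L n} → Formula L n → Set
BinaryCombination = BooleanCombination TwoFreeVariables

⊥′-binary : ∀ {L n} → BinaryCombination {L} {n} ⊥′
⊥′-binary {n = n} =
  base (Subset.⊥ , ≤-trans (≤-reflexive (∣⊥∣≡0 n)) z≤n , λ _ ())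

⊤′ : ∀ {L n} → Formula L n
⊤′ = ¬′ ⊥′

⊤′-binary : ∀ {L n} → BinaryCombination {L} {n} ⊤′
⊤′-binary = neg ⊥′-binary

⋁ : ∀ {L n} {A : Set} → (A → Formula L n) → List A → Formula L n
⋁ f List.[]       = ⊥′
⋁ f (a List.∷ as) = f a ∨′ ⋁ f as

⋁-binary : ∀ {L n} {A : Set} {f : A → Formula L n} →
           (∀ a → BinaryCombination (f a)) → ∀ as → BinaryCombination (⋁ f as)
⋁-binary f-binary List.[]       = ⊥′-binary
⋁-binary f-binary (a List.∷ as) = disj (f-binary a) (⋁-binary f-binary as)

⋀ : ∀ {L n m} → (Fin m → Formula L n) → Formula L n
⋀ {m = zero}  f = ⊤′
⋀ {m = suc m} f = f zero ∧′ ⋀ (f ∘ suc)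

⋀-binary : ∀ {L n m} {f : Fin m → Formula L n} →
           (∀ i → BinaryCombination (f i)) → BinaryCombination (⋀ f)
⋀-binary {m = zero}  f-binary = ⊤′-binary
⋀-binary {m = suc m} f-binary = conj (f-binary zero) (⋀-binary (f-binary ∘ suc))

-- The decision need not concern the tuple at which `φ` is evaluated: in a diagram it is taken at a
-- representative and fixes the sign.
literal : ∀ {L n} {A : Set} → Dec A → Formula L n → Formula L n
literal (yes _) φ = φ
literal (no  _) φ = ¬′ φ

literal-binary : ∀ {L n} {A : Set} (A? : Dec A) {φ : Formula L n} →
                 BinaryCombination φ → BinaryCombination (literal A? φ)
literal-binary (yes _) = id
literal-binary (no  _) = neg

module _ {L : Language} (𝓜 : Structure L) where
  open Structure 𝓜

  ⋁-sat⁺ : ∀ {n} {A : Set} {f : A → Formula L n} {ρ as} →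
           Any (λ a → Sat 𝓜 ρ (f a)) as → Sat 𝓜 ρ (⋁ f as)
  ⋁-sat⁺ (here s)  = inj₁ s
  ⋁-sat⁺ (there s) = inj₂ (⋁-sat⁺ s)

  ⋁-sat⁻ : ∀ {n} {A : Set} {f : A → Formula L n} {ρ} as →
           Sat 𝓜 ρ (⋁ f as) → Any (λ a → Sat 𝓜 ρ (f a)) as
  ⋁-sat⁻ (a List.∷ as) (inj₁ s) = here s
  ⋁-sat⁻ (a List.∷ as) (inj₂ s) = there (⋁-sat⁻ as s)

  ⋀-sat⁺ : ∀ {n m} {f : Fin m → Formula L n} {ρ} →
           (∀ i → Sat 𝓜 ρ (f i)) → Sat 𝓜 ρ (⋀ f)
  ⋀-sat⁺ {m = zero}  s = id
  ⋀-sat⁺ {m = suc m} s = s zero , ⋀-sat⁺ (s ∘ suc)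

  ⋀-sat⁻ : ∀ {n m} {f : Fin m → Formula L n} {ρ} →
           Sat 𝓜 ρ (⋀ f) → ∀ i → Sat 𝓜 ρ (f i)
  ⋀-sat⁻ (s , _)  zero    = s
  ⋀-sat⁻ (_ , ss) (suc i) = ⋀-sat⁻ ss i

  closure-sat : ∀ n (φ : Formula L n) → (∀ ρ → Sat 𝓜 ρ φ) → 𝓜 ⊨ closure n φ
  closure-sat zero    φ s = s []
  closure-sat (suc n) φ s = closure-sat n (all′ φ) (λ ρ a → s (a ∷ ρ))

-- Back and forth

module BackAndForth {L : Language} (𝓜 : Structure L) where
  open Structure 𝓜

  module _
    (_≈?_ : Decidable _≈_)
    (_∼_ : ∀ {n} → Vector Carrier n → Vector Carrier n → Set)
    (∼-refl : ∀ {n} {ρ : Vector Carrier n} → ρ ∼ ρ)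
    (∼-sym : ∀ {n} {ρ σ : Vector Carrier n} → ρ ∼ σ → σ ∼ ρ)
    (∼-empty : ∀ {ρ σ : Vector Carrier 0} → ρ ∼ σ)
    (eval-resp-∼ : ∀ {n} {ρ σ : Vector Carrier n} → ρ ∼ σ → ∀ s t →
                   eval 𝓜 ρ s ≈ eval 𝓜 ρ t → eval 𝓜 σ s ≈ eval 𝓜 σ t)
    (candidates : ∀ {n} → Vector Carrier n → List Carrier)
    -- The list depends on `σ` alone, not on the new entry of `ρ`. Its finiteness is what makes
    -- quantifiers decidable and the set of patterns finite.
    (forth : ∀ {n} {ρ : Vector Carrier (suc n)} {σ} → tail ρ ∼ σ →
             Any (λ c → ρ ∼ (c ∷ σ)) (candidates σ))
    (diagram : ∀ {n} → Vector Carrier n → Formula L n)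
    (diagram-binary : ∀ {n} (σ : Vector Carrier n) → BinaryCombination (diagram σ))
    (diagram-sat⁺ : ∀ {n} {ρ σ : Vector Carrier n} → ρ ∼ σ → Sat 𝓜 ρ (diagram σ))
    (diagram-sat⁻ : ∀ {n} {ρ σ : Vector Carrier n} → Sat 𝓜 ρ (diagram σ) → ρ ∼ σ)
    where

    -- Proving one direction suffices: symmetry of `∼` carries antecedents of implications
    -- backwards.
    sat-resp-∼ : ∀ {n} {ρ σ : Vector Carrier n} → ρ ∼ σ →
                 ∀ φ → Sat 𝓜 ρ φ → Sat 𝓜 σ φ
    sat-resp-∼ ρ∼σ (s ≐ t)  p        = eval-resp-∼ ρ∼σ s t p
    sat-resp-∼ ρ∼σ (φ ∧′ ψ) (p , q)  = sat-resp-∼ ρ∼σ φ p , sat-resp-∼ ρ∼σ ψ q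
    sat-resp-∼ ρ∼σ (φ ∨′ ψ) p        = Sum.map (sat-resp-∼ ρ∼σ φ) (sat-resp-∼ ρ∼σ ψ) p
    sat-resp-∼ ρ∼σ (φ ⇒′ ψ) p        = sat-resp-∼ ρ∼σ ψ ∘ p ∘ sat-resp-∼ (∼-sym ρ∼σ) φ
    sat-resp-∼ {ρ = ρ} ρ∼σ (all′ φ) p a =
      -- Here `a` extends `σ`, so the match `c` is sought over `ρ`, where `p` can be applied.
      let c , a∼c = Any.satisfied (forth {ρ = a ∷ _} (∼-sym ρ∼σ))
      in sat-resp-∼ (∼-sym a∼c) φ (p c)
    sat-resp-∼ ρ∼σ (ex′ φ) (a , p) =
      let c , a∼c = Any.satisfied (forth {ρ = a ∷ _} ρ∼σ)
      in c , sat-resp-∼ a∼c φ p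

    sat? : ∀ {n} (φ : Formula L n) ρ → Dec (Sat 𝓜 ρ φ)
    sat? (s ≐ t)  ρ = eval 𝓜 ρ s ≈? eval 𝓜 ρ t
    sat? ⊥′       ρ = no id
    sat? (φ ∧′ ψ) ρ = sat? φ ρ ×-dec sat? ψ ρ
    sat? (φ ∨′ ψ) ρ = sat? φ ρ ⊎-dec sat? ψ ρ
    sat? (φ ⇒′ ψ) ρ = sat? φ ρ →-dec sat? ψ ρ
    -- Testing finitely many candidates decides a quantifier over the whole domain: each `a ∷ ρ` is
    -- related to some `c ∷ ρ` with `c` a candidate.
    sat? (all′ φ) ρ = map′
      (λ ps a → All.lookupWith (λ p a∼c → sat-resp-∼ (∼-sym a∼c) φ p) ps
                  (forth {ρ = a ∷ ρ} ∼-refl))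
      (λ p → All.universal p (candidates ρ))
      (All.all? (λ c → sat? φ (c ∷ ρ)) (candidates ρ))
    sat? (ex′ φ)  ρ = map′
      Any.satisfied
      (λ (a , p) → Any.map (λ a∼c → sat-resp-∼ a∼c φ p) (forth {ρ = a ∷ ρ} ∼-refl))
      (Any.any? (λ c → sat? φ (c ∷ ρ)) (candidates ρ))

    representatives : ∀ n → List (Vector Carrier n)
    representatives zero    = [] List.∷ List.[]
    representatives (suc n) =
      concatMap (λ σ → List.map (_∷ σ) (candidates σ)) (representatives n)

    -- A representative of the tail extends, through `forth`, to one of the whole tuple.
    represented : ∀ {n} (ρ : Vector Carrier n) → Any (ρ ∼_) (representatives n)
    represented {zero}  ρ = here ∼-empty
    represented {suc n} ρ =
      concatMap⁺ _ (Any.map (λ ρ∼σ → map⁺ (forth ρ∼σ)) (represented (tail ρ)))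

    normalForm : ∀ {n} → Formula L n → Formula L n
    normalForm {n} φ = ⋁ diagram (filter (sat? φ) (representatives n))

    normalForm-sat⁺ : ∀ {n} (φ : Formula L n) ρ → Sat 𝓜 ρ φ → Sat 𝓜 ρ (normalForm φ)
    normalForm-sat⁺ φ ρ p =
      let _ , σ∈ , ρ∼σ = find (represented ρ)
      in ⋁-sat⁺ 𝓜 {f = diagram}
           (lose (∈-filter⁺ (sat? φ) σ∈ (sat-resp-∼ ρ∼σ φ p)) (diagram-sat⁺ ρ∼σ))

    -- The disjunct true at `ρ` is the diagram of some `σ` satisfying `φ`; hence `ρ ∼ σ`, and `φ`
    -- transfers back to `ρ`.
    normalForm-sat⁻ : ∀ {n} (φ : Formula L n) ρ → Sat 𝓜 ρ (normalForm φ) → Sat 𝓜 ρ φ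
    normalForm-sat⁻ φ ρ p =
      let _ , σ∈ , d = find (⋁-sat⁻ 𝓜 {f = diagram} (filter (sat? φ) (representatives _)) p)
      in sat-resp-∼ (∼-sym (diagram-sat⁻ d)) φ
           (proj₂ (∈-filter⁻ (sat? φ) {xs = representatives _} σ∈))

    binary : Binary (Th 𝓜)
    binary {n} φ =
      normalForm φ ,
      ⋁-binary diagram-binary _ ,
      -- The closed biconditional itself belongs to `Th 𝓜`, so its truth in `𝓜` settles it in every
      -- model.
      λ 𝓝 𝓝⊨Th → 𝓝⊨Th (closure n (φ ⇔′ normalForm φ))
        (closure-sat 𝓜 n (φ ⇔′ normalForm φ) (λ ρ → normalForm-sat⁺ φ ρ , normalForm-sat⁻ φ ρ))

-- Left-zero semigroup with a unit

infixl 7 _∙_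

_∙_ : ℕ → ℕ → ℕ
zero  ∙ y = y
suc x ∙ y = suc x

∙-assoc : Associative _≡_ _∙_
∙-assoc zero    y z = refl
∙-assoc (suc x) y z = refl

∙-identity : Identity _≡_ 0 _∙_
∙-identity = (λ _ → refl) , λ { zero → refl ; (suc _) → refl }

leftZeroMonoid : Monoid 0ℓ 0ℓ
leftZeroMonoid = record
  { isMonoid = record
    { isSemigroup = record
      { isMagma = record { isEquivalence = isEquivalence ; ∙-cong = cong₂ _∙_ }
      ; assoc   = ∙-assoc
      }
    ; identity = ∙-identity
    }
  }

-- Makes the unit definable from the operation alone, as the groupoid language requires. For
-- positive `x`, the instance `y = 0` is already the goal.
leftUnit⇒0 : ∀ x → (∀ y → x ∙ y ≡ y) → x ≡ 0
leftUnit⇒0 zero    _        = refl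
leftUnit⇒0 (suc x) leftUnit = leftUnit 0

-- Position zero of 0 ∷ ρ holds the unit, so patterns compare entries with each
-- other and with the unit alike.
_≼_ : ∀ {n} → Vector ℕ n → Vector ℕ n → Set
ρ ≼ σ = ∀ i j → (0 ∷ ρ) i ≡ (0 ∷ ρ) j → (0 ∷ σ) i ≡ (0 ∷ σ) j

_∼_ : ∀ {n} → Vector ℕ n → Vector ℕ n → Set
ρ ∼ σ = ρ ≼ σ × σ ≼ ρ

∼-refl : ∀ {n} {ρ : Vector ℕ n} → ρ ∼ ρ
∼-refl = (λ _ _ → id) , (λ _ _ → id)

-- With the unit at position zero, the new entry sits at position one, so old position `suc (suc i)`
-- is position `suc i` for the tail.
≼-extend : ∀ {n} {ρ σ : Vector ℕ (suc n)} → tail ρ ≼ tail σ →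
           (∀ k → ρ zero ≡ (0 ∷ tail ρ) k → σ zero ≡ (0 ∷ tail σ) k) → ρ ≼ σ
≼-extend ρ≼σ new zero          zero          eq = refl
≼-extend ρ≼σ new zero          (suc zero)    eq = sym (new zero (sym eq))
≼-extend ρ≼σ new zero          (suc (suc j)) eq = ρ≼σ zero (suc j) eq
≼-extend ρ≼σ new (suc zero)    zero          eq = new zero eq
≼-extend ρ≼σ new (suc zero)    (suc zero)    eq = refl
≼-extend ρ≼σ new (suc zero)    (suc (suc j)) eq = new (suc j) eq
≼-extend ρ≼σ new (suc (suc i)) zero          eq = ρ≼σ (suc i) zero eq
≼-extend ρ≼σ new (suc (suc i)) (suc zero)    eq = sym (new (suc i) (sym eq))
≼-extend ρ≼σ new (suc (suc i)) (suc (suc j)) eq = ρ≼σ (suc i) (suc j) eq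

-- The successor keeps the value off the unit as well as above every entry.
fresh : ∀ {n} → Vector ℕ n → ℕ
fresh σ = suc (foldr _⊔_ 0 σ)

lookup≤max : ∀ {n} (σ : Vector ℕ n) i → σ i ≤ foldr _⊔_ 0 σ
lookup≤max σ zero    = m≤m⊔n (σ zero) _
lookup≤max σ (suc i) = ≤-trans (lookup≤max (tail σ) i) (m≤n⊔m (σ zero) _)

fresh≢ : ∀ {n} (σ : Vector ℕ n) k → ¬ fresh σ ≡ (0 ∷ σ) k
fresh≢ σ (suc k) eq = 1+n≰n (≤-trans (≤-reflexive eq) (lookup≤max σ k))

candidates : ∀ {n} → Vector ℕ n → List ℕ
candidates σ = fresh σ List.∷ List.tabulate (0 ∷ σ)

forth : ∀ {n} {ρ : Vector ℕ (suc n)} {σ} → tail ρ ∼ σ →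
        Any (λ c → ρ ∼ (c ∷ σ)) (candidates σ)
forth {ρ = ρ} {σ} (ρ≼σ , σ≼ρ) with any? (λ k → ρ zero ≟ (0 ∷ tail ρ) k)
-- The new entry repeats position `k`, so it is matched by position `k` of `0 ∷ σ` and inherits that
-- position's equalities.
... | yes (k , eq) = there (tabulate⁺ {f = 0 ∷ σ} k
  ( ≼-extend ρ≼σ (λ j eq′ → ρ≼σ k j (trans (sym eq) eq′))
  , ≼-extend σ≼ρ (λ j eq′ → trans eq (σ≼ρ k j eq′))))
-- Neither new entry equals anything older, so both conditions hold vacuously.
... | no ¬old = here
  ( ≼-extend ρ≼σ (λ j eq → contradiction (j , eq) ¬old)
  , ≼-extend σ≼ρ (λ j eq → contradiction eq (fresh≢ σ j)))

Corresponding : ∀ {n} → Vector ℕ n → Vector ℕ n → ℕ → ℕ → Set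
Corresponding ρ σ x y = ∃[ k ] ((0 ∷ ρ) k ≡ x × (0 ∷ σ) k ≡ y)

-- A product returns one of its factors, chosen by whether the left one is 0. Related tuples make
-- the same choice.
∙-corresponding : ∀ {n} {ρ σ : Vector ℕ n} → ρ ∼ σ → ∀ {x y x′ y′} →
                  Corresponding ρ σ x y → Corresponding ρ σ x′ y′ →
                  Corresponding ρ σ (x ∙ x′) (y ∙ y′)
∙-corresponding ρ∼σ {zero}  {zero}  c                c′ = c′
∙-corresponding ρ∼σ {suc _} {suc _} c                c′ = c
-- Position `k` agrees with the unit's position in `ρ`, hence also in `σ`, where it holds a
-- successor.
∙-corresponding ρ∼σ {zero}  {suc _} (k , eqρ , eqσ) c′ =
  case trans (sym (proj₁ ρ∼σ k zero eqρ)) eqσ of λ ()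
∙-corresponding ρ∼σ {suc _} {zero}  (k , eqρ , eqσ) c′ =
  case trans (sym (proj₂ ρ∼σ k zero eqσ)) eqρ of λ ()

-- Equality patterns as binary formulas, uniformly in the language

module LeftZero
  {L : Language} (m : L 2)
  (interp : ∀ {k} → L k → Vector ℕ k → ℕ)
  (interp-cong : ∀ {k} (f : L k) {xs ys : Vector ℕ k} →
                 (∀ i → xs i ≡ ys i) → interp f xs ≡ interp f ys)
  where

  𝓜 : Structure L
  𝓜 = record { domain = setoid ℕ ; interp = interp ; interp-cong = interp-cong }

  module _
    (interp-m : ∀ xs → interp m xs ≡ xs zero ∙ xs (suc zero))
    (interp-corresponding : ∀ {k} (f : L k) {n} {ρ σ : Vector ℕ n} → ρ ∼ σ → ∀ {xs ys} →
                            (∀ j → Corresponding ρ σ (xs j) (ys j)) →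
                            Corresponding ρ σ (interp f xs) (interp f ys))
    where

    eval-corresponding : ∀ {n} {ρ σ : Vector ℕ n} → ρ ∼ σ → ∀ t →
                         Corresponding ρ σ (eval 𝓜 ρ t) (eval 𝓜 σ t)
    eval-corresponding ρ∼σ (var i)  = suc i , refl , refl
    eval-corresponding ρ∼σ (op f t) =
      interp-corresponding f ρ∼σ (λ j → eval-corresponding ρ∼σ (t j))

    -- Each term value is read off at one position common to both tuples, so an equation of terms
    -- becomes an equality of two positions.
    eval-resp-∼ : ∀ {n} {ρ σ : Vector ℕ n} → ρ ∼ σ → ∀ s t →
                  eval 𝓜 ρ s ≡ eval 𝓜 ρ t → eval 𝓜 σ s ≡ eval 𝓜 σ t
    eval-resp-∼ ρ∼σ s t eq =
      let i , ρi≡ , σi≡ = eval-corresponding ρ∼σ s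
          j , ρj≡ , σj≡ = eval-corresponding ρ∼σ t
      in trans (sym σi≡)
           (trans (proj₁ ρ∼σ i j (trans ρi≡ (trans eq (sym ρj≡)))) σj≡)

    isUnit : ∀ {n} → Fin n → Formula L n
    isUnit i = all′ (op m (var (suc i) ∷ var zero ∷ []) ≐ var zero)

    isUnit-sat⁺ : ∀ {n} {ρ : Vector ℕ n} i → ρ i ≡ 0 → Sat 𝓜 ρ (isUnit i)
    isUnit-sat⁺ i eq a = trans (interp-m _) (cong (_∙ a) eq)

    isUnit-sat⁻ : ∀ {n} {ρ : Vector ℕ n} i → Sat 𝓜 ρ (isUnit i) → ρ i ≡ 0
    isUnit-sat⁻ {ρ = ρ} i p = leftUnit⇒0 (ρ i)
      (λ a → trans (sym (interp-m _)) (p a))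

    isUnit-binary : ∀ {n} (i : Fin n) → BinaryCombination (isUnit i)
    isUnit-binary i = base (⁅ i ⁆ , ≤-trans (≤-reflexive (∣⁅x⁆∣≡1 i)) (s≤s z≤n) , λ k →
      λ { (inj₁ (zero , refl)) → x∈⁅x⁆ i
        ; (inj₁ (suc zero , ()))
        ; (inj₂ ()) })

    -- Indices are positions of `0 ∷ ρ`. Position zero is no variable, so comparison with it goes
    -- through `isUnit`.
    equal : ∀ {n} → Fin (suc n) → Fin (suc n) → Formula L n
    equal zero    zero    = ⊤′
    equal zero    (suc j) = isUnit j
    equal (suc i) zero    = isUnit i
    equal (suc i) (suc j) = var i ≐ var j

    equal-binary : ∀ {n} (i j : Fin (suc n)) → BinaryCombination (equal i j)
    equal-binary zero    zero    = ⊤′-binary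
    equal-binary zero    (suc j) = isUnit-binary j
    equal-binary (suc i) zero    = isUnit-binary i
    equal-binary (suc i) (suc j) = base (⁅ i ⁆ ∪ ⁅ j ⁆ , ∣⁅i⁆∪⁅j⁆∣≤2 i j , λ k →
      λ { (inj₁ refl) → x∈p∪q⁺ (inj₁ (x∈⁅x⁆ k))
        ; (inj₂ refl) → x∈p∪q⁺ {p = ⁅ i ⁆} (inj₂ (x∈⁅x⁆ k)) })

    equal-sat⁺ : ∀ {n} {ρ : Vector ℕ n} i j → (0 ∷ ρ) i ≡ (0 ∷ ρ) j → Sat 𝓜 ρ (equal i j)
    equal-sat⁺ zero    zero    eq = id
    equal-sat⁺ zero    (suc j) eq = isUnit-sat⁺ j (sym eq)
    equal-sat⁺ (suc i) zero    eq = isUnit-sat⁺ i eq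
    equal-sat⁺ (suc i) (suc j) eq = eq

    equal-sat⁻ : ∀ {n} {ρ : Vector ℕ n} i j → Sat 𝓜 ρ (equal i j) → (0 ∷ ρ) i ≡ (0 ∷ ρ) j
    equal-sat⁻ zero    zero    p = refl
    equal-sat⁻ zero    (suc j) p = sym (isUnit-sat⁻ j p)
    equal-sat⁻ (suc i) zero    p = isUnit-sat⁻ i p
    equal-sat⁻ (suc i) (suc j) p = p

    entry : ∀ {n} → Vector ℕ n → Fin (suc n) → Fin (suc n) → Formula L n
    entry σ i j = literal ((0 ∷ σ) i ≟ (0 ∷ σ) j) (equal i j)

    entry-sat⁺ : ∀ {n} {ρ σ : Vector ℕ n} → ρ ∼ σ → ∀ i j → Sat 𝓜 ρ (entry σ i j)
    entry-sat⁺ {ρ = ρ} {σ} ρ∼σ i j with (0 ∷ σ) i ≟ (0 ∷ σ) j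
    ... | yes eq = equal-sat⁺ i j (proj₂ ρ∼σ i j eq)
    ... | no ¬eq = λ p → ¬eq (proj₁ ρ∼σ i j (equal-sat⁻ i j p))

    entry-sat⁻ : ∀ {n} {ρ σ : Vector ℕ n} i j → Sat 𝓜 ρ (entry σ i j) →
                 ((0 ∷ ρ) i ≡ (0 ∷ ρ) j → (0 ∷ σ) i ≡ (0 ∷ σ) j) ×
                 ((0 ∷ σ) i ≡ (0 ∷ σ) j → (0 ∷ ρ) i ≡ (0 ∷ ρ) j)
    entry-sat⁻ {ρ = ρ} {σ} i j p with (0 ∷ σ) i ≟ (0 ∷ σ) j
    ... | yes eq = (λ _ → eq) , (λ _ → equal-sat⁻ i j p)
    ... | no ¬eq = (λ eq → ⊥-elim (p (equal-sat⁺ i j eq))) , (λ eq → contradiction eq ¬eq)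

    diagram : ∀ {n} → Vector ℕ n → Formula L n
    diagram σ = ⋀ (λ i → ⋀ (λ j → entry σ i j))

    diagram-binary : ∀ {n} (σ : Vector ℕ n) → BinaryCombination (diagram σ)
    diagram-binary σ = ⋀-binary (λ i → ⋀-binary (λ j →
      literal-binary ((0 ∷ σ) i ≟ (0 ∷ σ) j) (equal-binary i j)))

    diagram-sat⁺ : ∀ {n} {ρ σ : Vector ℕ n} → ρ ∼ σ → Sat 𝓜 ρ (diagram σ)
    diagram-sat⁺ {σ = σ} ρ∼σ =
      ⋀-sat⁺ 𝓜 {f = λ i → ⋀ (entry σ i)} (λ i → ⋀-sat⁺ 𝓜 {f = entry σ i} (entry-sat⁺ ρ∼σ i))

    diagram-sat⁻ : ∀ {n} {ρ σ : Vector ℕ n} → Sat 𝓜 ρ (diagram σ) → ρ ∼ σ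
    diagram-sat⁻ {ρ = ρ} {σ} p =
      (λ i j → proj₁ (agree i j)) , (λ i j → proj₂ (agree i j))
      where
      agree = λ i j → entry-sat⁻ {ρ = ρ} {σ} i j
        (⋀-sat⁻ 𝓜 {f = entry σ i}
          (⋀-sat⁻ 𝓜 {f = λ i → ⋀ (entry σ i)} p i) j)

    binary : Binary (Th 𝓜)
    binary = BackAndForth.binary 𝓜 _≟_ _∼_ ∼-refl swap
      -- For empty tuples the unit's position is the only one.
      (λ {ρ} {σ} → (λ { zero zero → id }) , (λ { zero zero → id }))
      eval-resp-∼ candidates forth diagram diagram-binary diagram-sat⁺ diagram-sat⁻

-- The monoid and its groupoid reduct

leftZeroMonoid-binary : Binary (Th (monoidStructure leftZeroMonoid))
leftZeroMonoid-binary = LeftZero.binary mul interp interp-cong (λ _ → refl)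
  λ { mul ρ∼σ c → ∙-corresponding ρ∼σ (c zero) (c (suc zero))
    -- The constant corresponds to itself through position zero.
    ; unit _ _  → zero , refl , refl }
  where open Structure (monoidStructure leftZeroMonoid)

leftZeroMagma-binary : Binary (Th (groupoidStructure (Monoid.magma leftZeroMonoid)))
leftZeroMagma-binary = LeftZero.binary mul interp interp-cong (λ _ → refl)
  λ { mul ρ∼σ c → ∙-corresponding ρ∼σ (c zero) (c (suc zero)) }
  where open Structure (groupoidStructure (Monoid.magma leftZeroMonoid))

mainTheorem2 : (Σ[ M ∈ Monoid 0ℓ 0ℓ ] (Infinite (Monoid.setoid M) × Binary (Th (monoidStructure M)))) ×
    (Σ[ G ∈ Magma 0ℓ 0ℓ ] (Infinite (Magma.setoid G) × Binary (Th (groupoidStructure G))))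
mainTheorem2 =
  (leftZeroMonoid , ℕ-infinite , leftZeroMonoid-binary) ,
  (Monoid.magma leftZeroMonoid , ℕ-infinite , leftZeroMagma-binary)
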